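{- Let $F=(W,R)$ be a Kripke frame of finite height $h$ such that every cluster of $F$ has at most $N$ elements, for some finite $N\geq 1$. Then $F$ is properly refinable: every finite partition of $W$ has a finite refinement that is a proper partition of $F$. Moreover, $F$ is $f$-properly refinable for $$f(x)=\exp^h_2\bigl((N+h+1)(\log_2 x+N)\bigr),$$ i.e. every finite partition $\mathcal{A}$ of $W$ has a proper refinement $\mathcal{B}$ with $|\mathcal{B}|\leq f(|\mathcal{A}|)$.
   Context: A (Kripke) frame is a pair $(W,R)$ with $W$ nonempty and $R\subseteq W\times W$. $R^0$ is the identity on $W$, $R^{i+1}=R^i\circ R$, and $R^*=\bigcup_{i\geq 0}R^i$ is the reflexive transitive closure. Put $x\sim_R y$ iff $xR^*y$ and $yR^*x$; the $\sim_R$-classes are the clusters of the frame. The skeleton of $F$ is the partial order on clusters given by $[x]\leq_R[y]$ iff $xR^*y$. A partial order has height $h$ if it contains a chain of cardinality $h$ and no larger chain; the height of a frame is the height of its skeleton. A partition of $W$ is a family of pairwise disjoint nonempty sets with union $W$; a partition $\mathcal{B}$ is a refinement of $\mathcal{A}$ if every member of $\mathcal{B}$ is contained in some member of $\mathcal{A}$. A partition $\mathcal{A}$ of $W$ is proper (for $F$) if for all $U,V\in\mathcal{A}$: if $uRv$ for some $u\in U$, $v\in V$, then for every $u\in U$ there is $v\in V$ with $uRv$. $\exp^0_2(x)=x$ and $\exp^{i+1}_2(x)=2^{\exp^i_2(x)}$. -}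

module Defs where

open import Level using (0ℓ)
open import Data.Nat using (ℕ; zero; suc; _+_; _*_; _^_; _≤_)
open import Data.Fin using (Fin)
open import Data.Product using (Σ; _×_; ∃; ∃-syntax)
open import Data.Sum using (_⊎_)
open import Relation.Nullary using (¬_)
open import Relation.Binary.PropositionalEquality using (_≡_; _≢_)
open import Relation.Binary.Construct.Closure.ReflexiveTransitive using (Star)
open import Function.Definitions using (Injective)

-- A Kripke frame: a carrier W (nonempty, witnessed separately) and R ⊆ W × W.
-- R* is the reflexive transitive closure (stdlib `Star`).

module _ {W : Set} (R : W → W → Set) where

  _∼_ : W → W → Set
  x ∼ y = Star R x y × Star R y x

  -- A chain of cardinality m in the skeleton: m pairwise distinct clusters
  -- (given by representatives c i) which are pairwise comparable in ≤_R.
  HasChain : ℕ → Set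
  HasChain m = Σ (Fin m → W) λ c →
      (∀ i j → i ≢ j → ¬ (c i ∼ c j))
    × (∀ i j → Star R (c i) (c j) ⊎ Star R (c j) (c i))

  HasHeight : ℕ → Set
  HasHeight h = HasChain h × (∀ m → HasChain m → m ≤ h)

  ClustersAtMost : ℕ → Set
  ClustersAtMost N = ∀ (f : Fin (suc N) → W) →
    (∀ i j → f i ∼ f j) → ¬ Injective _≡_ _≡_ f

  -- A finite partition of W into k blocks is represented by the block-labelling
  -- map a : W → Fin k (block i = { w | a w ≡ i }); blocks are disjoint and
  -- cover W by construction, nonemptiness is the surjectivity condition.
  IsPartition : {k : ℕ} → (W → Fin k) → Set
  IsPartition {k} a = ∀ (i : Fin k) → ∃[ w ] a w ≡ i

  Refines : {k m : ℕ} → (W → Fin m) → (W → Fin k) → Set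
  Refines {k} {m} b a = ∀ (j : Fin m) → ∃[ i ] (∀ w → b w ≡ j → a w ≡ i)

  Proper : {m : ℕ} → (W → Fin m) → Set
  Proper {m} b = ∀ (U V : Fin m) →
    (∃[ u ] ∃[ v ] (b u ≡ U × b v ≡ V × R u v)) →
    ∀ u → b u ≡ U → ∃[ v ] (b v ≡ V × R u v)

  ProperlyRefinable : Set
  ProperlyRefinable = ∀ (k : ℕ) (a : W → Fin k) → IsPartition a →
    ∃[ m ] Σ (W → Fin m) λ b → IsPartition b × Refines b a × Proper b

  -- f-properly refinable, with the bound given as a predicate
  -- Bound k m  meaning  m ≤ f(k)
  FProperlyRefinable : (ℕ → ℕ → Set) → Set
  FProperlyRefinable Bound = ∀ (k : ℕ) (a : W → Fin k) → IsPartition a →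
    ∃[ m ] Σ (W → Fin m) λ b → IsPartition b × Refines b a × Proper b × Bound k m

exp₂ : ℕ → ℕ → ℕ
exp₂ zero x = x
exp₂ (suc i) x = 2 ^ exp₂ i x

-- BoundF h N x b  ⇔  b ≤ f(x) = exp₂^h((N+h+1)(log₂ x + N))   (for x ≥ 1).
-- Since 2^((N+h+1)(log₂ x + N)) = x^(N+h+1) · 2^(N(N+h+1)), for h = h'+1 this is
-- b ≤ exp₂^h'(x^(N+h+1) · 2^(N(N+h+1))), an exact integer; for h = 0 (b ≤ a real r)
-- it is equivalent to 2^b ≤ 2^r = x^(N+1) · 2^(N(N+1)).
BoundF : ℕ → ℕ → ℕ → ℕ → Set
BoundF zero N x b = 2 ^ b ≤ x ^ (N + 0 + 1) * 2 ^ (N * (N + 0 + 1))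
BoundF (suc h') N x b =
  b ≤ exp₂ h' (x ^ (N + suc h' + 1) * 2 ^ (N * (N + suc h' + 1)))

{-# OPTIONS --safe #-}

-- Let R* have height h and clusters of size at most N.  Enumerate each cluster,
-- possibly with repetitions, by some e : Fin N → W, and code a point x = e i of
-- depth at most d + 1 by i together with, for every j, the colour of e j, the
-- set { l | R (e j) (e l) }, and the set of codes of the R-successors of e j of
-- depth at most d.  Two points with the same code are related by a bisimulation
-- respecting colours: a step inside the cluster is answered by the same index,
-- and a step to smaller depth by a successor with the same code.  The codes
-- depend on the choice of the enumerations and need not be bisimulation
-- invariant, so the refinement consists of the classes of the equivalence
-- relation generated by this bisimulation; there are at most as many as codes.

module Submission where

open import Defs
open import Level using (0ℓ)
open import Data.Nat using (ℕ; zero; suc; _+_; _*_; _^_; _≤_; z≤n; s≤s; NonZero; >-nonZero)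
open import Data.Nat.Properties
  using ( ≤-refl; ≤-trans; m≤n⇒m≤1+n; 1+n≰n; m≤n+m; *-comm; *-assoc; *-identityʳ
        ; *-mono-≤; *-monoˡ-≤; *-monoʳ-≤; +-mono-≤; +-comm; m≤m*n
        ; ^-distribˡ-+-*; ^-*-assoc; ^-monoʳ-≤; m^n>0; m^n≢0; m*n≢0; m≤m+n
        ; module ≤-Reasoning )
open import Data.Nat.Tactic.RingSolver using (solve-∀)
open import Data.Fin using (Fin; zero; suc; combine; funToFin; finToFun; punchOut)
open import Data.Fin.Properties
  using (¬Fin0; suc-injective; combine-injective; finToFun-funToFin; punchOut-injective; nonZeroIndex)
open import Data.Vec.Functional using (_∷_)
open import Data.Product using (Σ; _×_; _,_; ∃-syntax; proj₁; proj₂)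
open import Data.Sum using (_⊎_; inj₁; inj₂)
open import Data.Empty using (⊥; ⊥-elim)
open import Function using (_∘_; const; it)
open import Function.Definitions using (Injective)
open import Relation.Nullary using (¬_; Dec; yes; no; contradiction)
open import Relation.Nullary.Decidable using (decidable-stable)
open import Relation.Binary using (Rel; IsEquivalence)
import Relation.Binary.Construct.On as On
open import Relation.Binary.Construct.Closure.ReflexiveTransitive
  using (Star; ε; _◅_; _◅◅_; reverse)
open import Relation.Binary.PropositionalEquality
  using (_≡_; _≢_; refl; sym; trans; cong; subst)
open import Axiom.ExcludedMiddle using (ExcludedMiddle)

-- Coding propositions and functions by elements of finite sets.

indicator : {P : Set} → Dec P → Fin 2
indicator (yes _) = suc zero
indicator (no _)  = zero

indicator-transfer : {P Q : Set} (p? : Dec P) (q? : Dec Q) →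
  indicator p? ≡ indicator q? → P → Q
indicator-transfer _       (yes q) _  _ = q
indicator-transfer (yes _) (no _)  () _
indicator-transfer (no ¬p) (no _)  _  p = contradiction p ¬p

funToFin-injective : ∀ {m n} (f g : Fin m → Fin n) →
  funToFin f ≡ funToFin g → ∀ i → f i ≡ g i
funToFin-injective f g eq i =
  trans (sym (finToFun-funToFin f i))
        (trans (cong (λ l → finToFun l i) eq) (finToFun-funToFin g i))

-- The number of codes and its tower bound.

-- The factors count the index of the point and, for each of the `N` listed points, a set of
-- indices, a colour, and a set of codes of smaller depth. Depth counts clusters, so no point has
-- depth at most 0.
codes : (N k d : ℕ) → ℕ
codes N k zero    = 0
codes N k (suc d) = N * (2 ^ N * (k * 2 ^ codes N k d)) ^ N

1+n≤2^n : ∀ n → suc n ≤ 2 ^ n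
1+n≤2^n zero    = ≤-refl
1+n≤2^n (suc n) = begin
  1 + suc n           ≤⟨ +-mono-≤ (m^n>0 2 n) (1+n≤2^n n) ⟩
  2 ^ n + 2 ^ n       ≡⟨ double (2 ^ n) ⟩
  2 ^ suc n           ∎
  where
  open ≤-Reasoning
  double : ∀ x → x + x ≡ 2 * x
  double = solve-∀

n≤2^n : ∀ n → n ≤ 2 ^ n
n≤2^n n = ≤-trans (m≤n+m n 1) (1+n≤2^n n)

n≤exp₂ : ∀ i n → n ≤ exp₂ i n
n≤exp₂ zero    n = ≤-refl
n≤exp₂ (suc i) n = ≤-trans (n≤exp₂ i n) (n≤2^n (exp₂ i n))

-- Fails for `n` zero and `m` at least 2, hence `1 ≤ n`.
m*2^n≤2^[m*n] : ∀ m n .{{_ : NonZero m}} → 1 ≤ n → m * 2 ^ n ≤ 2 ^ (m * n)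
m*2^n≤2^[m*n] (suc m) n 1≤n = begin
  suc m * 2 ^ n       ≤⟨ *-monoˡ-≤ (2 ^ n) (1+n≤2^n m) ⟩
  2 ^ m * 2 ^ n       ≡⟨ sym (^-distribˡ-+-* 2 m n) ⟩
  2 ^ (m + n)         ≤⟨ ^-monoʳ-≤ 2 (+-mono-≤ (m≤m*n m n {{>-nonZero 1≤n}}) (≤-refl {n})) ⟩
  2 ^ (m * n + n)     ≡⟨ cong (2 ^_) (+-comm (m * n) n) ⟩
  2 ^ (suc m * n)     ∎
  where open ≤-Reasoning

m*exp₂≤exp₂ : ∀ i m n .{{_ : NonZero m}} → 1 ≤ n → m * exp₂ i n ≤ exp₂ i (m * n)
m*exp₂≤exp₂ zero    m n 1≤n = ≤-refl
m*exp₂≤exp₂ (suc i) m n 1≤n =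
  ≤-trans (m*2^n≤2^[m*n] m (exp₂ i n) (≤-trans 1≤n (n≤exp₂ i n)))
          (^-monoʳ-≤ 2 (m*exp₂≤exp₂ i m n 1≤n))

^-distribʳ-* : ∀ n a b → (a * b) ^ n ≡ a ^ n * b ^ n
^-distribʳ-* zero    a b = refl
^-distribʳ-* (suc n) a b = begin-equality
  a * b * (a * b) ^ n         ≡⟨ cong (a * b *_) (^-distribʳ-* n a b) ⟩
  a * b * (a ^ n * b ^ n)     ≡⟨ interchange a b (a ^ n) (b ^ n) ⟩
  a * a ^ n * (b * b ^ n)     ∎
  where
  open ≤-Reasoning
  interchange : ∀ a b c d → a * b * (c * d) ≡ a * c * (b * d)
  interchange = solve-∀

module _ (N k : ℕ) {{_ : NonZero k}} where

  private
    -- This is 2 to the power log₂ k + N, so the bound for height `suc d` is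
    -- `exp₂ d (B ^ (N + suc d + 1))`.
    B : ℕ
    B = k * 2 ^ N

    instance
      B≢0 : NonZero B
      B≢0 = m*n≢0 k (2 ^ N) {{it}} {{m^n≢0 2 N}}

  open ≤-Reasoning

  N<B : suc N ≤ B
  N<B = begin
    suc N       ≤⟨ 1+n≤2^n N ⟩
    2 ^ N       ≤⟨ m≤m*n (2 ^ N) k ⟩
    2 ^ N * k   ≡⟨ *-comm (2 ^ N) k ⟩
    B           ∎

  codes-suc : ∀ d → codes N k (suc d) ≤ B ^ suc N * 2 ^ (N * codes N k d)
  codes-suc d = begin
    N * (2 ^ N * (k * 2 ^ t)) ^ N   ≡⟨ cong (λ x → N * x ^ N) (regroup (2 ^ N) k (2 ^ t)) ⟩
    N * (B * 2 ^ t) ^ N             ≡⟨ cong (N *_) (^-distribʳ-* N B (2 ^ t)) ⟩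
    N * (B ^ N * (2 ^ t) ^ N)       ≡⟨ cong (λ x → N * (B ^ N * x)) (^-*-assoc 2 t N) ⟩
    N * (B ^ N * 2 ^ (t * N))       ≡⟨ sym (*-assoc N (B ^ N) _) ⟩
    N * B ^ N * 2 ^ (t * N)         ≡⟨ cong (λ x → N * B ^ N * 2 ^ x) (*-comm t N) ⟩
    N * B ^ N * 2 ^ (N * t)         ≤⟨ *-monoˡ-≤ (2 ^ (N * t)) (*-monoˡ-≤ (B ^ N) (≤-trans (m≤n+m N 1) N<B)) ⟩
    B ^ suc N * 2 ^ (N * t)         ∎
    where
    t : ℕ
    t = codes N k d
    regroup : ∀ p k q → p * (k * q) ≡ k * p * q
    regroup = solve-∀

  codes≤exp₂ : ∀ d → codes N k (suc d) ≤ exp₂ d (B ^ (N + suc d + 1))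
  codes≤exp₂ zero = begin
    codes N k 1                 ≤⟨ codes-suc 0 ⟩
    B ^ suc N * 2 ^ (N * 0)     ≡⟨ cong (λ x → B ^ suc N * 2 ^ x) (*-comm N 0) ⟩
    B ^ suc N * 1               ≡⟨ *-identityʳ _ ⟩
    B ^ suc N                   ≤⟨ ^-monoʳ-≤ B (m≤m+n (suc N) 1) ⟩
    B ^ (suc N + 1)             ≡⟨ cong (λ x → B ^ (x + 1)) (+-comm 1 N) ⟩
    B ^ (N + 1 + 1)             ∎
  codes≤exp₂ (suc d) = begin
    codes N k (suc (suc d))                   ≤⟨ codes-suc (suc d) ⟩
    B ^ suc N * 2 ^ (N * codes N k (suc d))   ≤⟨ *-mono-≤ B^≤2^E (^-monoʳ-≤ 2 (*-monoʳ-≤ N (codes≤exp₂ d))) ⟩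
    2 ^ E * 2 ^ (N * E)                       ≡⟨ sym (^-distribˡ-+-* 2 E (N * E)) ⟩
    2 ^ (suc N * E)                           ≤⟨ ^-monoʳ-≤ 2 (*-monoˡ-≤ E N<B) ⟩
    -- The factor `B` sinks to the bottom of the tower and becomes one more power of `B`; this is
    -- how the height enters the exponent.
    2 ^ (B * E)                               ≤⟨ ^-monoʳ-≤ 2 (m*exp₂≤exp₂ d B (B ^ (N + suc d + 1)) (m^n>0 B (N + suc d + 1))) ⟩
    2 ^ exp₂ d (B ^ suc (N + suc d + 1))      ≡⟨ cong (λ x → 2 ^ exp₂ d (B ^ x)) (shift N d) ⟩
    2 ^ exp₂ d (B ^ (N + suc (suc d) + 1))    ∎
    where
    E : ℕ
    E = exp₂ d (B ^ (N + suc d + 1))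
    shift : ∀ N d → suc (N + suc d + 1) ≡ N + suc (suc d) + 1
    shift = solve-∀
    exponent : ∀ N d → suc N + suc d ≡ N + suc d + 1
    exponent = solve-∀
    B^≤2^E : B ^ suc N ≤ 2 ^ E
    B^≤2^E = begin
      B ^ suc N                ≤⟨ ^-monoʳ-≤ B (m≤m+n (suc N) (suc d)) ⟩
      B ^ (suc N + suc d)      ≡⟨ cong (B ^_) (exponent N d) ⟩
      B ^ (N + suc d + 1)      ≤⟨ n≤exp₂ d _ ⟩
      E                        ≤⟨ n≤2^n E ⟩
      2 ^ E                    ∎

  codes-bound : ∀ d {m} → m ≤ codes N k d → BoundF d N k m
  -- Here `m` is 0, so the claim is that a product of positive powers is at least 1.
  codes-bound zero z≤n =
    *-mono-≤ (m^n>0 k (N + 0 + 1)) (m^n>0 2 (N * (N + 0 + 1)))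
  codes-bound (suc d) {m} m≤ = begin
    m                                          ≤⟨ m≤ ⟩
    codes N k (suc d)                          ≤⟨ codes≤exp₂ d ⟩
    exp₂ d (B ^ e)                             ≡⟨ cong (exp₂ d) (^-distribʳ-* e k (2 ^ N)) ⟩
    exp₂ d (k ^ e * (2 ^ N) ^ e)               ≡⟨ cong (λ x → exp₂ d (k ^ e * x)) (^-*-assoc 2 N e) ⟩
    exp₂ d (k ^ e * 2 ^ (N * e))               ∎
    where
    e : ℕ
    e = N + suc d + 1

-- Classical finite quotients and enumerations.

module _ (em : ExcludedMiddle 0ℓ) where

  stable : {P : Set} → ¬ ¬ P → P
  stable = decidable-stable em

  -- Removing the whole class of a point with code zero, rather than just the
  -- points with that code, keeps the labels of distinct classes distinct.
  finite-quotient : ∀ {n} {X : Set} {_≈_ : Rel X 0ℓ} → IsEquivalence _≈_ →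
    (c : X → Fin n) → (∀ {x y} → c x ≡ c y → x ≈ y) →
    ∃[ m ] Σ (X → Fin m) λ b → m ≤ n × (∀ i → ∃[ x ] b x ≡ i)
      × (∀ {x y} → x ≈ y → b x ≡ b y) × (∀ {x y} → b x ≡ b y → x ≈ y)
  finite-quotient {zero} eq c c-inj =
    0 , c , z≤n , (λ ()) , (λ {x} _ → ⊥-elim (¬Fin0 (c x))) , c-inj
  finite-quotient {suc n} {X} {_≈_} eq c c-inj with em {∃[ x ] c x ≡ zero}
  ... | no ∄x
      with m , b , m≤n , b-surj , b-resp , b-inj ←
        finite-quotient eq (λ x → punchOut {i = zero} {c x} (λ 0≡ → ∄x (x , sym 0≡)))
          (c-inj ∘ punchOut-injective {i = zero} _ _) =
      m , b , m≤n⇒m≤1+n m≤n , b-surj , b-resp , b-inj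
  ... | yes (x₀ , cx₀≡0)
      with m , b , m≤n , b-surj , b-resp , b-inj ←
        finite-quotient {X = ∃[ x ] ¬ (x₀ ≈ x)} (On.isEquivalence proj₁ eq)
          (λ (x , x₀≉x) → punchOut {i = zero} {c x} (λ 0≡ → x₀≉x (c-inj (trans cx₀≡0 0≡))))
          (c-inj ∘ punchOut-injective {i = zero} _ _) =
      suc m , (λ x → label x em) , s≤s m≤n , surj
        , (λ {x} {y} → resp x y em em) , (λ {x} {y} → inj x y em em)
      where
      module E = IsEquivalence eq
      label : ∀ x → Dec (x₀ ≈ x) → Fin (suc m)
      label x (yes _)   = zero
      label x (no x₀≉x) = suc (b (x , x₀≉x))

      surj : ∀ i → ∃[ x ] label x em ≡ i
      surj zero = x₀ , lemma em
        where
        lemma : ∀ d → label x₀ d ≡ zero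
        lemma (yes _)  = refl
        lemma (no x₀≉) = contradiction E.refl x₀≉
      surj (suc i) with (x , x₀≉x) , bx≡i ← b-surj i = x , lemma em
        where
        lemma : ∀ d → label x d ≡ suc i
        lemma (yes x₀≈x) = contradiction x₀≈x x₀≉x
        lemma (no _)     = cong suc (trans (b-resp E.refl) bx≡i)

      resp : ∀ x y dx dy → x ≈ y → label x dx ≡ label y dy
      resp x y (yes _) (yes _) x≈y = refl
      resp x y (yes p) (no ¬q) x≈y = contradiction (E.trans p x≈y) ¬q
      resp x y (no ¬p) (yes q) x≈y = contradiction (E.trans q (E.sym x≈y)) ¬p
      resp x y (no ¬p) (no ¬q) x≈y = cong suc (b-resp x≈y)

      inj : ∀ x y dx dy → label x dx ≡ label y dy → x ≈ y
      inj x y (yes p) (yes q) _ = E.trans (E.sym p) q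
      inj x y (no _)  (no _)  e = b-inj (suc-injective e)

  Enumerates : {W : Set} (n : ℕ) → (W → Set) → Set
  Enumerates {W} n P = Σ (Fin n → W) λ e → (∀ i → P (e i)) × (∀ z → P z → ∃[ i ] e i ≡ z)

  -- Starting from `x`, new points of `P` are added to an injective list as long as there are any.
  -- If the list exhausts `P` early, it is padded with copies of `x` up to length `n`.
  inject-or-enumerate : {W : Set} (P : W → Set) {x : W} → P x → ∀ n →
    (Σ (Fin (suc n) → W) λ f → Injective _≡_ _≡_ f × ∀ i → P (f i)) ⊎ Enumerates n P
  inject-or-enumerate P {x} px zero = inj₁ (const x , (λ { {zero} {zero} _ → refl }) , const px)
  inject-or-enumerate {W} P {x} px (suc n) with inject-or-enumerate P px n
  ... | inj₂ (e , e⊆P , P⊆e) =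
        inj₂ (x ∷ e , (λ { zero → px ; (suc i) → e⊆P i })
             , λ z pz → let i , ei≡z = P⊆e z pz in suc i , ei≡z)
  ... | inj₁ (f , f-inj , f⊆P) with em {∃[ z ] P z × ¬ (∃[ i ] f i ≡ z)}
  ...   | no ∄z = inj₂ (f , f⊆P , λ z pz → stable (λ ∄i → ∄z (z , pz , ∄i)))
  ...   | yes (z , pz , ∄i) = inj₁ (z ∷ f , inj , λ { zero → pz ; (suc i) → f⊆P i })
          where
          inj : Injective _≡_ _≡_ (z ∷ f)
          inj {zero}  {zero}  _ = refl
          inj {zero}  {suc j} e = contradiction (j , sym e) ∄i
          inj {suc i} {zero}  e = contradiction (i , e) ∄i
          inj {suc i} {suc j} e = cong suc (f-inj e)

  -- Depth of points and chains of clusters.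

  module _ {W : Set} (R : W → W → Set) where

    -- Recursive form of the condition that no chain of more than `d` clusters lies above `x`, the
    -- cluster of `x` included.
    DepthAtMost : ℕ → W → Set
    DepthAtMost zero    x = ⊥
    DepthAtMost (suc d) x = ∀ y → Star R x y → _∼_ R x y ⊎ DepthAtMost d y

    ChainAbove : ℕ → W → Set
    ChainAbove m x = Σ (HasChain R m) λ (c , _) → ∀ i → Star R x (c i)

    -- If some `y` strictly above `x` has a long chain above it, `x` extends that chain; otherwise
    -- the induction hypothesis bounds the depth of every such `y`.
    depth-or-chain : ∀ d x → DepthAtMost d x ⊎ ChainAbove (suc d) x
    depth-or-chain zero x =
      inj₂ ((const x , (λ { zero zero 0≢0 → contradiction refl 0≢0 }) , λ _ _ → inj₁ ε) , const ε)
    depth-or-chain (suc d) x with em {∃[ y ] Star R x y × ¬ _∼_ R x y × ChainAbove (suc d) y}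
    ... | no ∄y = inj₁ λ y xy → split y xy em
          where
          split : ∀ y → Star R x y → Dec (_∼_ R x y) → _∼_ R x y ⊎ DepthAtMost d y
          split y xy (yes x∼y) = inj₁ x∼y
          split y xy (no x≁y) with depth-or-chain d y
          ... | inj₁ p = inj₂ p
          ... | inj₂ c = contradiction (y , xy , x≁y , c) ∄y
    ... | yes (y , xy , x≁y , (c , distinct , comparable) , y≤c) =
          inj₂ ((x ∷ c , distinct′ , comparable′) , above)
          where
          above : ∀ i → Star R x ((x ∷ c) i)
          above zero    = ε
          above (suc i) = xy ◅◅ y≤c i

          c≰x : ∀ i → ¬ Star R (c i) x
          c≰x i cx = x≁y (xy , y≤c i ◅◅ cx)

          distinct′ : ∀ i j → i ≢ j → ¬ _∼_ R ((x ∷ c) i) ((x ∷ c) j)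
          distinct′ zero    zero    i≢j _        = i≢j refl
          distinct′ zero    (suc j) _   (_ , cx) = c≰x j cx
          distinct′ (suc i) zero    _   (cx , _) = c≰x i cx
          distinct′ (suc i) (suc j) i≢j          = distinct i j (i≢j ∘ cong suc)

          comparable′ : ∀ i j → Star R ((x ∷ c) i) ((x ∷ c) j) ⊎ Star R ((x ∷ c) j) ((x ∷ c) i)
          comparable′ zero    j       = inj₁ (above j)
          comparable′ (suc i) zero    = inj₂ (above (suc i))
          comparable′ (suc i) (suc j) = comparable i j

    height⇒depth : ∀ {h} → HasHeight R h → ∀ x → DepthAtMost h x
    height⇒depth {h} (_ , maximal) x with depth-or-chain h x
    ... | inj₁ p       = p
    ... | inj₂ (c , _) = contradiction (maximal (suc h) c) 1+n≰n

    -- Enumerated clusters and codes of points.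

    module _ {N : ℕ} (small : ClustersAtMost R N) where

      cluster-enumeration : ∀ x → Enumerates N (_∼_ R x)
      cluster-enumeration x with inject-or-enumerate (_∼_ R x) (ε , ε) N
      ... | inj₂ e = e
      ... | inj₁ (f , f-inj , x∼f) = ⊥-elim
              (small f (λ i j → proj₂ (x∼f i) ◅◅ proj₁ (x∼f j) , proj₂ (x∼f j) ◅◅ proj₁ (x∼f i)) f-inj)

      enum : W → Fin N → W
      enum x = proj₁ (cluster-enumeration x)

      index : ∀ x → ∃[ i ] enum x i ≡ x
      index x = proj₂ (proj₂ (cluster-enumeration x)) x (ε , ε)

      module _ {k : ℕ} (a : W → Fin k) where

        SuccessorWithCode : ∀ {n} d → (∀ z → DepthAtMost d z → Fin n) → W → Fin n → Set
        SuccessorWithCode d c y l = ∃[ z ] Σ (DepthAtMost d z) λ p → R y z × c z p ≡ l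

        -- Taking an enumeration instead of a point allows rows of different enumerations of one
        -- cluster to be compared; taking `c` as a parameter allows `code` to recurse through it.
        row : ∀ {n} d → (∀ z → DepthAtMost d z → Fin n) →
              (Fin N → W) → Fin N → Fin (2 ^ N * (k * 2 ^ n))
        row d c e j = combine (funToFin λ l → indicator (em {R (e j) (e l)}))
          (combine (a (e j)) (funToFin λ l → indicator (em {SuccessorWithCode d c (e j) l})))

        row-agree : ∀ {n} d (c : ∀ z → DepthAtMost d z → Fin n) e e′ j →
          row d c e j ≡ row d c e′ j →
          (∀ l → R (e j) (e l) → R (e′ j) (e′ l)) × a (e j) ≡ a (e′ j) ×
          (∀ l → SuccessorWithCode d c (e j) l → SuccessorWithCode d c (e′ j) l)
        row-agree d c e e′ j eq
          with edges , rest ← combine-injective (funToFin λ l → indicator (em {R (e j) (e l)})) _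
                                (funToFin λ l → indicator (em {R (e′ j) (e′ l)})) _ eq
          with colour , successors ← combine-injective (a (e j)) _ (a (e′ j)) _ rest =
          (λ l → indicator-transfer em em (funToFin-injective _ _ edges l)) , colour ,
          (λ l → indicator-transfer em em (funToFin-injective _ _ successors l))

        code : ∀ d x → DepthAtMost d x → Fin (codes N k d)
        code zero    x ()
        code (suc d) x _ = combine (proj₁ (index x)) (funToFin (row d (code d) (enum x)))

        -- Under this condition the rows account for every successor of a listed point, either by
        -- its index or by its code.
        Closed : ℕ → (Fin N → W) → Set
        Closed d e = ∀ i z → R (e i) z → (∃[ l ] e l ≡ z) ⊎ DepthAtMost d z

        enum-closed : ∀ {d x} → DepthAtMost (suc d) x → Closed d (enum x)
        enum-closed {x = x} p i z r with cluster-enumeration x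
        ... | e , x∼e , x∼⊆e with p z (proj₁ (x∼e i) ◅◅ r ◅ ε)
        ...   | inj₁ x∼z = inj₁ (x∼⊆e z x∼z)
        ...   | inj₂ q   = inj₂ q

        -- The bisimulation and its classes.

        -- Equality of codes would not survive a step inside a cluster, since `e l` may have an
        -- enumeration of its own other than `e`. Relating all indices of two fixed enumerations at
        -- once avoids this.
        data _≃_ : W → W → Set where
          matched : ∀ d {e e′} → Closed d e → Closed d e′ →
            (∀ j → row d (code d) e j ≡ row d (code d) e′ j) → ∀ i → e i ≃ e′ i

        ≃-sym : ∀ {x y} → x ≃ y → y ≃ x
        ≃-sym (matched d closed closed′ rows i) = matched d closed′ closed (sym ∘ rows) i

        code-injective : ∀ d {x y} (p : DepthAtMost d x) (q : DepthAtMost d y) →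
          code d x p ≡ code d y q → x ≃ y
        code-injective (suc d) {x} {y} p q eq
          with cx , ix ← index x | cy , iy ← index y
          -- Equal codes put `x` and `y` at the same index of their enumerations; `ix` and `iy` then
          -- identify the listed points with `x` and `y`.
          with refl , keys ← combine-injective cx _ cy _ eq =
          subst (_≃ _) ix (subst (_ ≃_) iy
            (matched d (enum-closed p) (enum-closed q) (funToFin-injective _ _ keys) cx))

        ≃-colour : ∀ {x y} → x ≃ y → a x ≡ a y
        ≃-colour (matched d {e} {e′} _ _ rows i) =
          proj₁ (proj₂ (row-agree d (code d) e e′ i (rows i)))

        -- The converse half of the bisimulation condition follows by `≃-sym`.
        ≃-zig : ∀ {x y z} → x ≃ y → R x z → ∃[ w ] z ≃ w × R y w
        ≃-zig {z = z} (matched d {e} {e′} closed closed′ rows i) r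
          with edges , _ , successors ← row-agree d (code d) e e′ i (rows i)
          with closed i z r
        -- The same pair of enumerations witnesses the new match, at index `l`.
        ... | inj₁ (l , refl) = e′ l , matched d closed closed′ rows l , edges l r
        ... | inj₂ p
          with w , q , r′ , eq ← successors (code d z p) (z , p , r , refl) =
              w , code-injective d p q (sym eq) , r′

        ≃*-colour : ∀ {x y} → Star _≃_ x y → a x ≡ a y
        ≃*-colour ε        = refl
        ≃*-colour (s ◅ ss) = trans (≃-colour s) (≃*-colour ss)

        ≃*-zig : ∀ {x y z} → Star _≃_ x y → R x z → ∃[ w ] Star _≃_ z w × R y w
        ≃*-zig ε        r = _ , ε , r
        ≃*-zig (s ◅ ss) r =
          let _ , t  , r′ = ≃-zig s r
              w , ts , r″ = ≃*-zig ss r′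
          in w , t ◅ ts , r″

        ≃*-isEquivalence : IsEquivalence (Star _≃_)
        ≃*-isEquivalence = record { refl = ε ; sym = reverse ≃-sym ; trans = _◅◅_ }

        proper-refinement : ∀ {h} → (∀ x → DepthAtMost h x) →
          ∃[ m ] Σ (W → Fin m) λ b →
            IsPartition R b × Refines R b a × Proper R b × m ≤ codes N k h
        proper-refinement {h} depth
          with m , b , m≤ , b-surj , b-resp , b-inj ←
            -- All points are coded at the common depth `h`, and equal codes give a single `≃` step,
            -- so the classes of the generated equivalence are no more numerous than the codes.
            finite-quotient ≃*-isEquivalence (λ x → code h x (depth x))
              (λ eq → code-injective h _ _ eq ◅ ε) =
          m , b , b-surj , refines , proper , m≤
          where
          refines : Refines R b a
          refines j with w , bw≡j ← b-surj j =
            a w , λ w′ bw′≡j → ≃*-colour (b-inj (trans bw′≡j (sym bw≡j)))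

          proper : Proper R b
          proper U V (u , v , bu≡U , bv≡V , r) u′ bu′≡U
            with v′ , v≃*v′ , r′ ← ≃*-zig (b-inj (trans bu≡U (sym bu′≡U))) r =
            v′ , trans (sym (b-resp v≃*v′)) bv≡V , r′

theorem1 : ExcludedMiddle 0ℓ →
    (W : Set) (R : W → W → Set) → W →
    (h N : ℕ) → HasHeight R h → 1 ≤ N → ClustersAtMost R N →
    ProperlyRefinable R × FProperlyRefinable R (BoundF h N)
theorem1 em W R w h N height _ small =
  (λ k a part →
    let m , b , b-part , refines , proper , _ = refinable k a part
    in m , b , b-part , refines , proper) ,
  refinable
  where
  refinable : FProperlyRefinable R (BoundF h N)
  refinable k a _
    with m , b , b-part , refines , proper , m≤ ←
      proper-refinement em R small a (height⇒depth em R height) =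
    -- The point `w` has a label in `Fin k`, so `k` is nonzero.
    m , b , b-part , refines , proper , codes-bound N k {{nonZeroIndex (a w)}} h m≤
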